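{- A permutation $\pi\in\mathcal{S}_n$ is a Schröder permutation (i.e. avoids both $1243$ and $2143$) if and only if every element $(i,j)$ of its essential set $\mathcal{E}(\pi)$ has rank $\rho(i,j)\le 1$.
   Context: For $\pi=\pi_1\cdots\pi_n\in\mathcal{S}_n$ and $\tau\in\mathcal{S}_k$, $\pi$ contains the pattern $\tau$ if there are indices $i_1<\dots<i_k$ with $\pi_{i_1}\cdots\pi_{i_k}$ in the same relative order as $\tau_1\cdots\tau_k$; otherwise $\pi$ avoids $\tau$. Represent $\pi$ by an $n\times n$ array, rows $i=1,\dots,n$ numbered top to bottom and columns $j=1,\dots,n$ left to right, with a dot in square $(i,\pi_i)$. The diagram $D(\pi)$ is the set of squares $(i,j)$ with $\pi_i>j$ and $\pi^{ -1}(j)>i$. The essential set $\mathcal{E}(\pi)$ is the set of squares $(i,j)\in D(\pi)$ such that $(i+1,j)\notin D(\pi)$ and $(i,j+1)\notin D(\pi)$ (squares outside the array count as not in $D(\pi)$). The rank of a square $(i,j)$ is $\rho(i,j)=\#\{k<i:\pi_k<j\}$, the number of dots strictly northwest of it. -}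

module Defs where

open import Data.Fin.Base using (Fin; toℕ; _<_; _>_)
open import Data.Fin.Patterns using (0F; 1F; 2F; 3F)
open import Data.Fin.Permutation using (Permutation′; permutation; _⟨$⟩ʳ_; _⟨$⟩ˡ_)
open import Data.Fin.Properties using (_<?_)
open import Data.Fin.Subset using (Subset; ∣_∣)
open import Data.Nat.Base using (ℕ; suc)
open import Data.Product.Base using (_×_; _,_; Σ-syntax)
open import Data.Vec.Base using (lookup; tabulate; []; _∷_)
open import Function.Bundles using (_⇔_)
open import Level using (0ℓ)
open import Relation.Binary.PropositionalEquality.Core using (_≡_; refl)
open import Relation.Nullary.Decidable.Core using (does; _×-dec_)
open import Relation.Nullary.Negation.Core using (¬_)
open import Relation.Unary using (Pred; _∈_; _∉_)

private
  variable
    n k : ℕ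

-- Positions, values, rows and columns are all numbered from 0 rather than
-- from 1: π ⟨$⟩ʳ i is π at i, and π ⟨$⟩ˡ j is π⁻¹ at j.

Contains : Permutation′ n → Permutation′ k → Set
Contains {n} {k} π τ =
  Σ[ e ∈ (Fin k → Fin n) ]
    (∀ (a b : Fin k) → a < b → e a < e b) ×
    (∀ (a b : Fin k) → (π ⟨$⟩ʳ (e a) < π ⟨$⟩ʳ (e b)) ⇔ (τ ⟨$⟩ʳ a < τ ⟨$⟩ʳ b))

Avoids : Permutation′ n → Permutation′ k → Set
Avoids π τ = ¬ Contains π τ

-- Both patterns are involutions, so the same word serves as the inverse.

⟪1243⟫ : Permutation′ 4
⟪1243⟫ = permutation word word involutive involutive
  where
  word : Fin 4 → Fin 4
  word = lookup (0F ∷ 1F ∷ 3F ∷ 2F ∷ [])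
  involutive : ∀ i → word (word i) ≡ i
  involutive 0F = refl
  involutive 1F = refl
  involutive 2F = refl
  involutive 3F = refl

⟪2143⟫ : Permutation′ 4
⟪2143⟫ = permutation word word involutive involutive
  where
  word : Fin 4 → Fin 4
  word = lookup (1F ∷ 0F ∷ 3F ∷ 2F ∷ [])
  involutive : ∀ i → word (word i) ≡ i
  involutive 0F = refl
  involutive 1F = refl
  involutive 2F = refl
  involutive 3F = refl

Schröder : Permutation′ n → Set
Schröder π = Avoids π ⟪1243⟫ × Avoids π ⟪2143⟫

-- A square (i , j) is in row i (from the top) and column j (from the left).
Square : ℕ → Set
Square n = Fin n × Fin n

Diagram : Permutation′ n → Pred (Square n) 0ℓ
Diagram π (i , j) = π ⟨$⟩ʳ i > j × π ⟨$⟩ˡ j > i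

-- If row i + 1 (or column j + 1) is outside the array, the corresponding
-- condition holds vacuously: squares outside the array are not in the diagram.
Essential : Permutation′ n → Pred (Square n) 0ℓ
Essential π (i , j) =
  (i , j) ∈ Diagram π ×
  (∀ i′ → toℕ i′ ≡ suc (toℕ i) → (i′ , j) ∉ Diagram π) ×
  (∀ j′ → toℕ j′ ≡ suc (toℕ j) → (i , j′) ∉ Diagram π)

rowsOfDotsNW : Permutation′ n → Square n → Subset n
rowsOfDotsNW π (i , j) = tabulate λ k → does ((k <? i) ×-dec ((π ⟨$⟩ʳ k) <? j))

rank : Permutation′ n → Square n → ℕ
rank π s = ∣ rowsOfDotsNW π s ∣

{-# OPTIONS --safe #-}

-- Containing one of the patterns means having dots in rows k₁ < k₂ < i < l with
-- π l < π i and both π k₁, π k₂ < π l.  Then (i , π l) is a square of the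
-- diagram with at least two dots northwest of it; conversely any such square
-- (i , j) gives these four dots with l = π⁻¹ j.  Every square of the diagram
-- can be moved down and right inside the diagram until it is essential, and
-- its rank does not decrease on the way.
module Submission where

open import Defs
open import Data.Bool.Properties using (T-≡)
open import Data.Empty using (⊥)
open import Data.Fin.Base using (Fin; zero; suc; toℕ; _<_; _>_) renaming (_≤_ to _≤ᶠ_)
open import Data.Fin.Induction using (>-wellFounded)
open import Data.Fin.Patterns using (0F; 1F; 2F; 3F)
open import Data.Fin.Permutation using (Permutation′; _⟨$⟩ʳ_; _⟨$⟩ˡ_; inverseˡ; inverseʳ)
open import Data.Fin.Properties using (<-cmp; _<?_; any?)
open import Data.Fin.Subset using (Subset; inside; outside; ∣_∣; Nonempty) renaming (_∈_ to _∈ˢ_)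
open import Data.Nat.Base using (ℕ; suc; _≤_; z≤n; s≤s; s≤s⁻¹; z<s; s<s)
import Data.Nat.Properties as ℕ
open import Data.Product.Base using (_×_; _,_; ∃-syntax; ∃₂)
open import Data.Sum.Base using (_⊎_; inj₁; inj₂; [_,_])
open import Data.Vec.Base using (Vec; lookup; tabulate; []; _∷_; here; there)
open import Data.Vec.Properties using (lookup∘tabulate; []=⇒lookup; lookup⇒[]=)
open import Data.Vec.Relation.Unary.Linked using (Linked; [-]; _∷_)
open import Data.Vec.Relation.Unary.Linked.Properties using (lookup⁺)
open import Function.Base using (_∘_; case_of_)
open import Function.Bundles using (_⇔_; mk⇔; Equivalence; Injection)
open import Function.Properties.Inverse using (↔⇒↣)
open import Induction.WellFounded using (Acc; acc)
open import Relation.Binary.Definitions using (tri<; tri≈; tri>)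
open import Relation.Binary.PropositionalEquality.Core using (_≡_; refl; sym; trans; cong; subst; subst₂)
open import Relation.Nullary.Decidable using (Dec; yes; no; does; toWitness; _×-dec_; dec-true; isYes≗does)
open import Relation.Nullary.Negation.Core using (contradiction)
open import Relation.Unary using (_∈_)

open Equivalence using (from)

private
  variable
    n k : ℕ

0<∣p∣⇒Nonempty : (p : Subset n) → 1 ≤ ∣ p ∣ → Nonempty p
0<∣p∣⇒Nonempty (inside  ∷ p) _   = zero , here
0<∣p∣⇒Nonempty (outside ∷ p) 0<∣p∣ with 0<∣p∣⇒Nonempty p 0<∣p∣
... | x , x∈p = suc x , there x∈p

-- The pair comes out in increasing order so that it can serve directly as the rows `k₁ < k₂` of an
-- obstruction.
1<∣p∣⇒pair : (p : Subset n) → 2 ≤ ∣ p ∣ → ∃₂ λ x y → x < y × x ∈ˢ p × y ∈ˢ p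
1<∣p∣⇒pair (inside  ∷ p) 1<∣p∣ with 0<∣p∣⇒Nonempty p (s≤s⁻¹ 1<∣p∣)
... | y , y∈p = zero , suc y , z<s , here , there y∈p
1<∣p∣⇒pair (outside ∷ p) 1<∣p∣ with 1<∣p∣⇒pair p 1<∣p∣
... | x , y , x<y , x∈p , y∈p = suc x , suc y , s<s x<y , there x∈p , there y∈p

x∈p⇒0<∣p∣ : {x : Fin n} {p : Subset n} → x ∈ˢ p → 1 ≤ ∣ p ∣
x∈p⇒0<∣p∣ here                            = s≤s z≤n
x∈p⇒0<∣p∣ {p = inside  ∷ _} (there x∈p) = s≤s z≤n
x∈p⇒0<∣p∣ {p = outside ∷ _} (there x∈p) = x∈p⇒0<∣p∣ x∈p

pair⇒1<∣p∣ : {x y : Fin n} {p : Subset n} → x < y → x ∈ˢ p → y ∈ˢ p → 2 ≤ ∣ p ∣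
pair⇒1<∣p∣ {y = suc _} x<y here (there y∈p) = s≤s (x∈p⇒0<∣p∣ y∈p)
pair⇒1<∣p∣ {p = inside  ∷ _} x<y (there x∈p) (there y∈p) =
  ℕ.m≤n⇒m≤1+n (pair⇒1<∣p∣ (s≤s⁻¹ x<y) x∈p y∈p)
pair⇒1<∣p∣ {p = outside ∷ _} x<y (there x∈p) (there y∈p) =
  pair⇒1<∣p∣ (s≤s⁻¹ x<y) x∈p y∈p

module _ (π : Permutation′ n) where

  private
    NW? : ((i , j) : Square n) (k : Fin n) → Dec (k < i × π ⟨$⟩ʳ k < j)
    NW? (i , j) k = (k <? i) ×-dec ((π ⟨$⟩ʳ k) <? j)

  ∈-rowsOfDotsNW⁺ : ∀ {i j k} → k < i → π ⟨$⟩ʳ k < j → k ∈ˢ rowsOfDotsNW π (i , j)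
  ∈-rowsOfDotsNW⁺ {i} {j} {k} k<i πk<j = lookup⇒[]= k _
    (trans (lookup∘tabulate (does ∘ NW? (i , j)) k)
           (dec-true (NW? (i , j) k) (k<i , πk<j)))

  ∈-rowsOfDotsNW⁻ : ∀ i j {k} → k ∈ˢ rowsOfDotsNW π (i , j) → k < i × π ⟨$⟩ʳ k < j
  ∈-rowsOfDotsNW⁻ i j {k} k∈ = toWitness {a? = NW? (i , j) k} (from T-≡
    -- `toWitness` expects `isYes`, whereas the subset is tabulated with `does`.
    (trans (isYes≗does (NW? (i , j) k))
           (trans (sym (lookup∘tabulate (does ∘ NW? (i , j)) k)) ([]=⇒lookup k∈))))

  ⟨$⟩ʳ-injective : ∀ {i j} → π ⟨$⟩ʳ i ≡ π ⟨$⟩ʳ j → i ≡ j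
  ⟨$⟩ʳ-injective = Injection.injective (↔⇒↣ π)

  -- The second condition lists the values of the occurrence in increasing order.
  contains : (τ : Permutation′ k) (rows : Vec (Fin n) k) → Linked _<_ rows →
             Linked _<_ (tabulate λ v → π ⟨$⟩ʳ lookup rows (τ ⟨$⟩ˡ v)) →
             Contains π τ
  contains τ rows rows↗ values↗ = lookup rows , (λ a b → lookup⁺ ℕ.<-trans rows↗) , same-order
    where
    -- The list is indexed by value, so its entry at `τ ⟨$⟩ʳ a` sits in the row with index
    -- `τ⁻¹ (τ a) = a`.
    value-at : ∀ a → lookup (tabulate λ v → π ⟨$⟩ʳ lookup rows (τ ⟨$⟩ˡ v)) (τ ⟨$⟩ʳ a)
                     ≡ π ⟨$⟩ʳ lookup rows a
    value-at a = trans (lookup∘tabulate _ (τ ⟨$⟩ʳ a))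
                       (cong (λ x → π ⟨$⟩ʳ lookup rows x) (inverseˡ τ))

    τ<⇒π< : ∀ a b → τ ⟨$⟩ʳ a < τ ⟨$⟩ʳ b → π ⟨$⟩ʳ lookup rows a < π ⟨$⟩ʳ lookup rows b
    τ<⇒π< a b τa<τb = subst₂ _<_ (value-at a) (value-at b) (lookup⁺ ℕ.<-trans values↗ τa<τb)

    same-order : ∀ a b → (π ⟨$⟩ʳ lookup rows a < π ⟨$⟩ʳ lookup rows b) ⇔ (τ ⟨$⟩ʳ a < τ ⟨$⟩ʳ b)
    same-order a b = mk⇔ π<⇒τ< (τ<⇒π< a b)
      where
      π<⇒τ< : π ⟨$⟩ʳ lookup rows a < π ⟨$⟩ʳ lookup rows b → τ ⟨$⟩ʳ a < τ ⟨$⟩ʳ b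
      -- The converse follows by trichotomy: equal values of `τ` force `a ≡ b`, and the opposite
      -- order would give `π` the opposite order too.
      π<⇒τ< πa<πb with <-cmp (τ ⟨$⟩ʳ a) (τ ⟨$⟩ʳ b)
      ... | tri< τa<τb _ _ = τa<τb
      ... | tri≈ _ τa≡τb _ = contradiction πa<πb (ℕ.<-irrefl
              (cong (λ x → toℕ (π ⟨$⟩ʳ lookup rows x)) (Injection.injective (↔⇒↣ τ) τa≡τb)))
      ... | tri> _ _ τb<τa = contradiction (τ<⇒π< b a τb<τa) (ℕ.<-asym πa<πb)

  -- The order of `π k₁` and `π k₂` is left open: it is the only point where the two patterns
  -- differ, so one record covers both.
  record Obstruction : Set where
    field
      {k₁ k₂ i l} : Fin n
      k₁<k₂   : k₁ < k₂
      k₂<i    : k₂ < i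
      i<l     : i < l
      πk₁<πl  : π ⟨$⟩ʳ k₁ < π ⟨$⟩ʳ l
      πk₂<πl  : π ⟨$⟩ʳ k₂ < π ⟨$⟩ʳ l
      πl<πi   : π ⟨$⟩ʳ l < π ⟨$⟩ʳ i

  1243⇒obstruction : Contains π ⟪1243⟫ → Obstruction
  1243⇒obstruction (e , e↗ , order) = record
    { k₁<k₂ = e↗ 0F 1F (s≤s z≤n)
    ; k₂<i = e↗ 1F 2F (s≤s (s≤s z≤n))
    ; i<l = e↗ 2F 3F (s≤s (s≤s (s≤s z≤n)))
    -- Counting from 0, the pattern has value 2 at position 3 and value 3 at position 2; the proofs
    -- are of 0 < 2, 1 < 2 and 2 < 3.
    ; πk₁<πl = from (order 0F 3F) (s≤s z≤n)
    ; πk₂<πl = from (order 1F 3F) (s≤s (s≤s z≤n))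
    ; πl<πi = from (order 3F 2F) (s≤s (s≤s (s≤s z≤n)))
    }

  2143⇒obstruction : Contains π ⟪2143⟫ → Obstruction
  2143⇒obstruction (e , e↗ , order) = record
    { k₁<k₂ = e↗ 0F 1F (s≤s z≤n)
    ; k₂<i = e↗ 1F 2F (s≤s (s≤s z≤n))
    ; i<l = e↗ 2F 3F (s≤s (s≤s (s≤s z≤n)))
    ; πk₁<πl = from (order 0F 3F) (s≤s (s≤s z≤n))
    ; πk₂<πl = from (order 1F 3F) (s≤s z≤n)
    ; πl<πi = from (order 3F 2F) (s≤s (s≤s (s≤s z≤n)))
    }

  obstruction⇒contains : Obstruction → Contains π ⟪1243⟫ ⊎ Contains π ⟪2143⟫
  obstruction⇒contains o = case <-cmp (π ⟨$⟩ʳ k₁) (π ⟨$⟩ʳ k₂) of λ where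
      (tri< πk₁<πk₂ _ _) →
        -- The chain runs by value, hence through `l` before `i`.
        inj₁ (contains ⟪1243⟫ rows rows↗ (πk₁<πk₂ ∷ πk₂<πl ∷ πl<πi ∷ [-]))
      (tri≈ _ πk₁≡πk₂ _) →
        contradiction k₁<k₂ (ℕ.<-irrefl (cong toℕ (⟨$⟩ʳ-injective πk₁≡πk₂)))
      (tri> _ _ πk₂<πk₁) →
        inj₂ (contains ⟪2143⟫ rows rows↗ (πk₂<πk₁ ∷ πk₁<πl ∷ πl<πi ∷ [-]))
    where
    open Obstruction o

    rows : Vec (Fin n) 4
    rows = k₁ ∷ k₂ ∷ i ∷ l ∷ []

    rows↗ : Linked _<_ rows
    rows↗ = k₁<k₂ ∷ k₂<i ∷ i<l ∷ [-]

  Diagram? : ∀ s → Dec (s ∈ Diagram π)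
  Diagram? (i , j) = (j <? (π ⟨$⟩ʳ i)) ×-dec (i <? (π ⟨$⟩ˡ j))

  -- Greedy walk: step down while the square below is in the diagram, otherwise right. Each step
  -- raises one coordinate and fixes the other, so the walk ends.
  essential-SE : ∀ {i j} → (i , j) ∈ Diagram π →
                 ∃₂ λ i′ j′ → i ≤ᶠ i′ × j ≤ᶠ j′ × (i′ , j′) ∈ Essential π
  essential-SE = search (>-wellFounded _) (>-wellFounded _)
    where
    search : ∀ {i j} → Acc _>_ i → Acc _>_ j → (i , j) ∈ Diagram π →
             ∃₂ λ i′ j′ → i ≤ᶠ i′ × j ≤ᶠ j′ × (i′ , j′) ∈ Essential π
    search {i} {j} (acc below) (acc right) ij∈D
      with any? (λ i′ → (toℕ i′ ℕ.≟ suc (toℕ i)) ×-dec Diagram? (i′ , j))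
         | any? (λ j′ → (toℕ j′ ℕ.≟ suc (toℕ j)) ×-dec Diagram? (i , j′))
    ... | yes (_ , i′≡1+i , ∈D) | _ =
      let i<i′ = ℕ.≤-reflexive (sym i′≡1+i)
          i″ , j″ , i′≤i″ , j≤j″ , ∈E = search (below i<i′) (acc right) ∈D
      in  i″ , j″ , ℕ.≤-trans (ℕ.<⇒≤ i<i′) i′≤i″ , j≤j″ , ∈E
    ... | no _ | yes (_ , j′≡1+j , ∈D) =
      let j<j′ = ℕ.≤-reflexive (sym j′≡1+j)
          i″ , j″ , i≤i″ , j′≤j″ , ∈E = search (acc below) (right j<j′) ∈D
      in  i″ , j″ , i≤i″ , ℕ.≤-trans (ℕ.<⇒≤ j<j′) j′≤j″ , ∈E
    -- The two failed searches are exactly the remaining conditions of `Essential`, also at the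
    -- border, where no next index exists.
    ... | no ¬below | no ¬right =
      i , j , ℕ.≤-refl , ℕ.≤-refl , ij∈D ,
      (λ i′ i′≡1+i ∈D → ¬below (i′ , i′≡1+i , ∈D)) ,
      (λ j′ j′≡1+j ∈D → ¬right (j′ , j′≡1+j , ∈D))

  obstruction⇒rank>1 : Obstruction → ∃[ s ] s ∈ Essential π × 2 ≤ rank π s
  obstruction⇒rank>1 o =
    let i′ , j′ , i≤i′ , πl≤j′ , ∈E =
          -- The walk starts at `(i , π l)`, whose column has its dot in row `l` below `i`.
          essential-SE (πl<πi , subst (i <_) (sym (inverseˡ π)) i<l)
        k₂<i′ = ℕ.<-≤-trans k₂<i i≤i′
    in  (i′ , j′) , ∈E ,
        pair⇒1<∣p∣ k₁<k₂
          (∈-rowsOfDotsNW⁺ (ℕ.<-trans k₁<k₂ k₂<i′) (ℕ.<-≤-trans πk₁<πl πl≤j′))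
          (∈-rowsOfDotsNW⁺ k₂<i′ (ℕ.<-≤-trans πk₂<πl πl≤j′))
    where open Obstruction o

  rank>1⇒obstruction : ∀ {s} → s ∈ Diagram π → 2 ≤ rank π s → Obstruction
  rank>1⇒obstruction {i , j} (j<πi , i<π⁻¹j) rank>1 =
    let k₁ , k₂ , k₁<k₂ , k₁∈NW , k₂∈NW = 1<∣p∣⇒pair (rowsOfDotsNW π (i , j)) rank>1
        _    , πk₁<j = ∈-rowsOfDotsNW⁻ i j k₁∈NW
        k₂<i , πk₂<j = ∈-rowsOfDotsNW⁻ i j k₂∈NW
        -- The field `i<l` fixes `l` as `π⁻¹ j`, so bounds by `j` must be rewritten as bounds by
        -- `π l`.
        j≡ππ⁻¹j = sym (inverseʳ π)
    in  record
          { k₁<k₂  = k₁<k₂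
          ; k₂<i   = k₂<i
          ; i<l    = i<π⁻¹j
          ; πk₁<πl = subst (π ⟨$⟩ʳ k₁ <_) j≡ππ⁻¹j πk₁<j
          ; πk₂<πl = subst (π ⟨$⟩ʳ k₂ <_) j≡ππ⁻¹j πk₂<j
          ; πl<πi  = subst (_< π ⟨$⟩ʳ i) j≡ππ⁻¹j j<πi
          }

theorem2p1 : (n : ℕ) (π : Permutation′ n) →
    Schröder π ⇔ (∀ (s : Square n) → s ∈ Essential π → rank π s ≤ 1)
theorem2p1 n π = mk⇔ schröder⇒rank≤1 rank≤1⇒schröder
  where
  schröder⇒rank≤1 : Schröder π → ∀ s → s ∈ Essential π → rank π s ≤ 1
  schröder⇒rank≤1 (avoids1243 , avoids2143) s (s∈D , _) = ℕ.≮⇒≥ λ rank>1 →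
    [ avoids1243 , avoids2143 ] (obstruction⇒contains π (rank>1⇒obstruction π s∈D rank>1))

  rank≤1⇒schröder : (∀ s → s ∈ Essential π → rank π s ≤ 1) → Schröder π
  rank≤1⇒schröder rank≤1 = absurd ∘ 1243⇒obstruction π , absurd ∘ 2143⇒obstruction π
    where
    absurd : Obstruction π → ⊥
    absurd o =
      let s , s∈E , rank>1 = obstruction⇒rank>1 π o
      in  ℕ.<⇒≱ rank>1 (rank≤1 s s∈E)
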